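{- Let $P_{\mathrm{rook}}(t)=\sum_{n\ge 0}p_{\mathrm{rook},n}t^n$, where $p_{\mathrm{rook},n}$ is the number of Catalan rook paths from $(0,0)$ to $(n,n)$. Then, as formal power series, $$P_{\mathrm{rook}}(t)=\frac{1+3t-\sqrt{1-10t+9t^2}}{8t}=\frac{\beta}{2},\qquad\text{where } \beta=\frac{1+3t-\sqrt{1-10t+9t^2}}{4t}.$$
   Context: A lattice path with step set $S\subseteq\mathbb{N}\times\mathbb{N}$ from $(0,0)$ to $(n,m)$ is a finite (possibly empty) sequence of steps in $S$ summing to $(n,m)$; its nodes are $(0,0)$ and the points reached after each step. The path is Catalan if every node $(x,y)$ satisfies $x<y+1$, i.e. $x\le y$. A rook path is a path with step set $S=\{(a,0),(0,a):a>0\}$, $a$ an integer. The square root is the power series square root with constant term $1$. -}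

module Defs where

open import Data.Bool.Base using (if_then_else_)
open import Data.Fin.Base as Fin using (Fin; toℕ)
import Data.Fin.Properties as Fin
open import Data.Integer.Base using (+_; 1ℤ)
open import Data.List.Base
  using (List; []; _∷_; foldr; length; filter; deduplicate; upTo;
         cartesianProduct; cartesianProductWith)
open import Data.List.Membership.Propositional using (_∈_)
open import Data.List.Membership.Propositional.Properties
open import Data.List.Properties using (≡-dec)
open import Data.List.Relation.Unary.All as All using (All; []; _∷_)
open import Data.List.Relation.Unary.Any using (here; there)
open import Data.List.Relation.Unary.Unique.Propositional using (Unique)
import Data.List.Relation.Unary.Unique.DecPropositional.Properties as Unique
open import Data.List.Scans.Base using (scanl)
open import Data.Nat.Base as ℕ using (ℕ; zero; suc; z≤n; s≤s; s≤s⁻¹)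
import Data.Nat.Properties as ℕ
open import Data.Product.Base using (_×_; _,_; proj₁; proj₂)
import Data.Product.Properties as Product
open import Data.Rational.Base as ℚ using (ℚ; 0ℚ; 1ℚ; ½)
import Data.Rational.Properties as ℚ
import Data.Rational.Unnormalised.Base as ℚᵘ
import Data.Rational.Unnormalised.Properties as ℚᵘ
open import Data.Rational.Solver using (module +-*-Solver)
open import Level using (0ℓ)
open import Relation.Binary.Definitions using (DecidableEquality)
open import Relation.Binary.PropositionalEquality
  using (_≡_; _≢_; _≗_; refl; sym; trans; cong; cong₂; module ≡-Reasoning)
open import Relation.Nullary using (does; yes; no; _×-dec_)
open import Relation.Nullary.Decidable using (dec-true; dec-false)
open import Relation.Unary using (Pred; Decidable)

open import Algebra.Properties.CommutativeMonoid.Sum ℚ.+-0-commutativeMonoid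
  using (sum; sum-cong-≗; sum-init-last; sum-replicate-zero)

Point : Set
Point = ℕ × ℕ

origin : Point
origin = 0 , 0

infixl 6 _⊕_
_⊕_ : Point → Point → Point
(x , y) ⊕ (x′ , y′) = x ℕ.+ x′ , y ℕ.+ y′

_≟ᴾ_ : DecidableEquality Point
_≟ᴾ_ = Product.≡-dec ℕ._≟_ ℕ._≟_

IsPathTo : Pred Point 0ℓ → Point → Pred (List Point) 0ℓ
IsPathTo S q p = All S p × foldr _⊕_ origin p ≡ q

nodes : List Point → List Point
nodes = scanl _⊕_ origin

IsCatalan : Pred (List Point) 0ℓ
IsCatalan p = All (λ (x , y) → x ℕ.< y ℕ.+ 1) (nodes p)

data RookStep : Pred Point 0ℓ where
  horizontal : ∀ {a} → a ℕ.> 0 → RookStep (a , 0)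
  vertical   : ∀ {a} → a ℕ.> 0 → RookStep (0 , a)

IsCatalanRookPathTo : Point → Pred (List Point) 0ℓ
IsCatalanRookPathTo q p = IsPathTo RookStep q p × IsCatalan p

record Enumeration {A : Set} (P : Pred A 0ℓ) : Set where
  field
    elements : List A
    unique   : Unique elements
    sound    : ∀ {x} → x ∈ elements → P x
    complete : ∀ {x} → P x → x ∈ elements

  cardinality : ℕ
  cardinality = length elements

enumerate : {A : Set} {P : Pred A 0ℓ} → DecidableEquality A → Decidable P →
            (xs : List A) → (∀ {x} → P x → x ∈ xs) → Enumeration P
enumerate _≟_ P? xs P⊆xs = record
  { elements = deduplicate _≟_ (filter P? xs)
  ; unique   = Unique.deduplicate-! _≟_ (filter P? xs)
  ; sound    = λ x∈ → proj₂ (∈-filter⁻ P? {xs = xs} (∈-deduplicate⁻ _≟_ (filter P? xs) x∈))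
  ; complete = λ Px → ∈-deduplicate⁺ _≟_ (∈-filter⁺ P? (P⊆xs Px) Px)
  }

rookStep? : Decidable RookStep
rookStep? (zero  , zero)  = no λ { (horizontal ()) ; (vertical ()) }
rookStep? (zero  , suc y) = yes (vertical (s≤s z≤n))
rookStep? (suc x , zero)  = yes (horizontal (s≤s z≤n))
rookStep? (suc x , suc y) = no λ ()

isCatalanRookPathTo? : ∀ q → Decidable (IsCatalanRookPathTo q)
isCatalanRookPathTo? q p =
  (All.all? rookStep? p ×-dec (foldr _⊕_ origin p ≟ᴾ q))
  ×-dec All.all? (λ (x , y) → x ℕ.<? y ℕ.+ 1) (nodes p)

-- A finite list containing every candidate path: the words of length at
-- most k with letters in [0,N] × [0,M].
words : Point → ℕ → List (List Point)
words (N , M) zero    = [] ∷ []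
words (N , M) (suc k) = [] ∷ cartesianProductWith _∷_
  (cartesianProduct (upTo (suc N)) (upTo (suc M))) (words (N , M) k)

rookStep-positive : ∀ {x y} → RookStep (x , y) → 1 ℕ.≤ x ℕ.+ y
rookStep-positive (horizontal {a} a>0) = ℕ.≤-trans a>0 (ℕ.m≤m+n a 0)
rookStep-positive (vertical a>0)       = a>0

paths⊆words : ∀ {N M} k p → All RookStep p →
              let (n , m) = foldr _⊕_ origin p in
              n ℕ.≤ N → m ℕ.≤ M → n ℕ.+ m ℕ.≤ k → p ∈ words (N , M) k
paths⊆words zero    [] [] _ _ _ = here refl
paths⊆words (suc k) [] [] _ _ _ = here refl
paths⊆words k ((x , y) ∷ p) (s ∷ ss) n≤N m≤M n+m≤k = go k n+m≤k
  where
  n = proj₁ (foldr _⊕_ origin p)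
  m = proj₂ (foldr _⊕_ origin p)

  decrease : suc (n ℕ.+ m) ℕ.≤ (x ℕ.+ n) ℕ.+ (y ℕ.+ m)
  decrease = begin
    1 ℕ.+ (n ℕ.+ m)         ≤⟨ ℕ.+-monoˡ-≤ (n ℕ.+ m) (rookStep-positive s) ⟩
    x ℕ.+ y ℕ.+ (n ℕ.+ m)   ≡⟨ interchange x y n m ⟩
    x ℕ.+ n ℕ.+ (y ℕ.+ m)   ∎
    where
    open ℕ.≤-Reasoning
    open import Algebra.Properties.CommutativeSemigroup ℕ.+-commutativeSemigroup
      using (interchange)

  go : ∀ k → (x ℕ.+ n) ℕ.+ (y ℕ.+ m) ℕ.≤ k → (x , y) ∷ p ∈ words _ k
  go zero    bound with () ← ℕ.≤-trans decrease bound
  go (suc k) bound = there (∈-cartesianProductWith⁺ _∷_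
    (∈-cartesianProduct⁺ (∈-upTo⁺ (s≤s (ℕ.≤-trans (ℕ.m≤m+n x n) n≤N)))
                         (∈-upTo⁺ (s≤s (ℕ.≤-trans (ℕ.m≤m+n y m) m≤M))))
    (paths⊆words k p ss
      (ℕ.≤-trans (ℕ.m≤n+m n x) n≤N) (ℕ.≤-trans (ℕ.m≤n+m m y) m≤M)
      (s≤s⁻¹ (ℕ.≤-trans decrease bound))))

catalanRookPaths : ∀ q → Enumeration (IsCatalanRookPathTo q)
catalanRookPaths q@(n , m) =
  enumerate (≡-dec _≟ᴾ_) (isCatalanRookPathTo? q) (words q (n ℕ.+ m))
    λ { {p} ((steps , refl) , _) →
        paths⊆words (n ℕ.+ m) p steps ℕ.≤-refl ℕ.≤-refl ℕ.≤-refl }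

p-rook : ℕ → ℕ
p-rook n = Enumeration.cardinality (catalanRookPaths (n , n))

-- Formal power series over ℚ as coefficient sequences; equality of series
-- is _≗_.
Series : Set
Series = ℕ → ℚ

infixl 6 _+_ _-_
infixl 7 _*_ _÷_

_+_ _-_ _*_ : Series → Series → Series
(f + g) n = f n ℚ.+ g n
(f - g) n = f n ℚ.- g n
(f * g) n = sum {suc n} λ i → f (toℕ i) ℚ.* g (n ℕ.∸ toℕ i)

constant : ℕ → Series
constant c zero    = + c ℚ./ 1
constant c (suc _) = 0ℚ

t : Series
t 1 = 1ℚ
t _ = 0ℚ

generatingFunction : (ℕ → ℕ) → Series
generatingFunction a n = + a n ℚ./ 1

_÷_ : Series → (d : ℕ) .{{_ : ℕ.NonZero d}} → Series
(f ÷ d) n = f n ℚ.* (1ℤ ℚ./ d)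

-- The quotient f / (d t); see /t-correct.
infix 7 _/_t[_]
_/_t[_] : (f : Series) (d : ℕ) .{{_ : ℕ.NonZero d}} → .(f 0 ≡ 0ℚ) → Series
(f / d t[ _ ]) n = f (suc n) ℚ.* (1ℤ ℚ./ d)

sum-zero : ∀ {n} (v : Fin n → ℚ) → (∀ i → v i ≡ 0ℚ) → sum v ≡ 0ℚ
sum-zero {n} v v≡0 = trans (sum-cong-≗ v≡0) (sum-replicate-zero n)

constant-* : ∀ c f n → (constant c * f) n ≡ (+ c ℚ./ 1) ℚ.* f n
constant-* c f n = trans
  (cong ((+ c ℚ./ 1) ℚ.* f n ℚ.+_) (sum-zero {n} _ λ i → ℚ.*-zeroˡ (f (n ℕ.∸ suc (toℕ i)))))
  (ℚ.+-identityʳ _)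

t-*-zero : ∀ f → (t * f) 0 ≡ 0ℚ
t-*-zero f = trans (ℚ.+-identityʳ (0ℚ ℚ.* f 0)) (ℚ.*-zeroˡ (f 0))

t-*-suc : ∀ f n → (t * f) (suc n) ≡ f n
t-*-suc f n = begin
  0ℚ ℚ.* f (suc n) ℚ.+ (1ℚ ℚ.* f n ℚ.+ rest)
    ≡⟨ cong₂ (λ x y → x ℚ.+ (y ℚ.+ rest)) (ℚ.*-zeroˡ (f (suc n))) (ℚ.*-identityˡ (f n)) ⟩
  0ℚ ℚ.+ (f n ℚ.+ rest)
    ≡⟨ ℚ.+-identityˡ _ ⟩
  f n ℚ.+ rest
    ≡⟨ cong (f n ℚ.+_) (sum-zero {n} _ λ i → ℚ.*-zeroˡ (f (n ℕ.∸ suc (toℕ i)))) ⟩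
  f n ℚ.+ 0ℚ
    ≡⟨ ℚ.+-identityʳ (f n) ⟩
  f n ∎
  where
  open ≡-Reasoning
  rest = sum {n} λ i → 0ℚ ℚ.* f (n ℕ.∸ suc (toℕ i))

scalar-inverse : ∀ d .{{_ : ℕ.NonZero d}} → (+ d ℚ./ 1) ℚ.* (1ℤ ℚ./ d) ≡ 1ℚ
scalar-inverse d@(suc _) = ℚ.toℚᵘ-injective (begin
  ℚ.toℚᵘ ((+ d ℚ./ 1) ℚ.* (1ℤ ℚ./ d))
    ≈⟨ ℚ.toℚᵘ-homo-* (+ d ℚ./ 1) (1ℤ ℚ./ d) ⟩
  ℚ.toℚᵘ (+ d ℚ./ 1) ℚᵘ.* ℚ.toℚᵘ (1ℤ ℚ./ d)
    ≈⟨ ℚᵘ.*-cong (ℚ.toℚᵘ-fromℚᵘ (ℚᵘ.mkℚᵘ (+ d) 0)) (ℚ.toℚᵘ-fromℚᵘ (ℚᵘ.mkℚᵘ 1ℤ _)) ⟩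
  ℚᵘ.mkℚᵘ (+ d) 0 ℚᵘ.* (1ℤ ℚᵘ./ d)
    ≈⟨ ℚᵘ.*-inverseʳ (ℚᵘ.mkℚᵘ (+ d) 0) ⟩
  ℚᵘ.1ℚᵘ ∎)
  where open ℚᵘ.≃-Reasoning

scalar-cancel : ∀ d .{{_ : ℕ.NonZero d}} x → (+ d ℚ./ 1) ℚ.* (x ℚ.* (1ℤ ℚ./ d)) ≡ x
scalar-cancel d x = begin
  (+ d ℚ./ 1) ℚ.* (x ℚ.* (1ℤ ℚ./ d))
    ≡⟨ solve 3 (λ a x b → a :* (x :* b) := x :* (a :* b)) refl (+ d ℚ./ 1) x (1ℤ ℚ./ d) ⟩
  x ℚ.* ((+ d ℚ./ 1) ℚ.* (1ℤ ℚ./ d))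
    ≡⟨ cong (x ℚ.*_) (scalar-inverse d) ⟩
  x ℚ.* 1ℚ
    ≡⟨ ℚ.*-identityʳ x ⟩
  x ∎
  where
  open ≡-Reasoning
  open +-*-Solver

÷-correct : ∀ f d .{{_ : ℕ.NonZero d}} → constant d * (f ÷ d) ≗ f
÷-correct f d n = trans (constant-* d (f ÷ d) n) (scalar-cancel d (f n))

/t-correct : ∀ f d .{{_ : ℕ.NonZero d}} (f₀ : f 0 ≡ 0ℚ) →
             constant d * (t * (f / d t[ f₀ ])) ≗ f
/t-correct f d f₀ zero    = begin
  (constant d * (t * q)) 0       ≡⟨ constant-* d (t * q) 0 ⟩
  (+ d ℚ./ 1) ℚ.* (t * q) 0      ≡⟨ cong ((+ d ℚ./ 1) ℚ.*_) (t-*-zero q) ⟩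
  (+ d ℚ./ 1) ℚ.* 0ℚ             ≡⟨ ℚ.*-zeroʳ (+ d ℚ./ 1) ⟩
  0ℚ                             ≡⟨ f₀ ⟨
  f 0                            ∎
  where
  open ≡-Reasoning
  q = f / d t[ f₀ ]
/t-correct f d f₀ (suc n) = begin
  (constant d * (t * q)) (suc n)   ≡⟨ constant-* d (t * q) (suc n) ⟩
  (+ d ℚ./ 1) ℚ.* (t * q) (suc n)  ≡⟨ cong ((+ d ℚ./ 1) ℚ.*_) (t-*-suc q n) ⟩
  (+ d ℚ./ 1) ℚ.* q n              ≡⟨ scalar-cancel d (f (suc n)) ⟩
  f (suc n)                        ∎
  where
  open ≡-Reasoning
  q = f / d t[ f₀ ]

-- Polynomial of degree ≤ n with constant term 1 whose square agrees with f
-- up to tⁿ. In the step from g to g + c tⁿ⁺¹ the coefficient of tⁿ⁺¹ in the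
-- square grows by 2c.
approx : Series → ℕ → Series
approx f zero    = constant 1
approx f (suc n) k =
  if does (k ℕ.≟ suc n)
  then ½ ℚ.* (f (suc n) ℚ.- (approx f n * approx f n) (suc n))
  else approx f n k

-- The square root with constant term 1: see √-constant, √-square and √-unique.
√_[_] : (f : Series) → .(f 0 ≡ 1ℚ) → Series
√ f [ _ ] n = approx f n n

*-cong-≤ : ∀ {f f′ g g′} n → (∀ {i} → i ℕ.≤ n → f i ≡ f′ i) →
           (∀ {i} → i ℕ.≤ n → g i ≡ g′ i) → (f * g) n ≡ (f′ * g′) n
*-cong-≤ n f≡f′ g≡g′ = sum-cong-≗ λ i →
  cong₂ ℚ._*_ (f≡f′ (s≤s⁻¹ (Fin.toℕ<n i))) (g≡g′ (ℕ.m∸n≤m n (toℕ i)))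

-- The product without the two extreme terms of the convolution.
inner : Series → Series → ℕ → ℚ
inner f g n = sum {n} λ i → f (suc (toℕ i)) ℚ.* g (n ℕ.∸ toℕ i)

*-ends : ∀ f g n → (f * g) (suc n) ≡
         f 0 ℚ.* g (suc n) ℚ.+ (inner f g n ℚ.+ f (suc n) ℚ.* g 0)
*-ends f g n = cong (f 0 ℚ.* g (suc n) ℚ.+_) (trans
  (sum-init-last {n} (λ i → f (suc (toℕ i)) ℚ.* g (n ℕ.∸ toℕ i)))
  (cong₂ ℚ._+_
    (sum-cong-≗ {n} λ i → cong (λ j → f (suc j) ℚ.* g (n ℕ.∸ j)) (Fin.toℕ-inject₁ i))
    (trans (cong (λ j → f (suc j) ℚ.* g (n ℕ.∸ j)) (Fin.toℕ-fromℕ n))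
           (cong (λ j → f (suc n) ℚ.* g j) (ℕ.n∸n≡0 n)))))

inner-cong : ∀ {f g} n → (∀ {i} → i ℕ.≤ n → f i ≡ g i) → inner f f n ≡ inner g g n
inner-cong n f≡g = sum-cong-≗ {n} λ i →
  cong₂ ℚ._*_ (f≡g (Fin.toℕ<n i)) (f≡g (ℕ.m∸n≤m n (toℕ i)))

approx-new : ∀ f n → approx f (suc n) (suc n) ≡
             ½ ℚ.* (f (suc n) ℚ.- (approx f n * approx f n) (suc n))
approx-new f n rewrite dec-true (suc n ℕ.≟ suc n) refl = refl

approx-old : ∀ f n {k} → k ≢ suc n → approx f (suc n) k ≡ approx f n k
approx-old f n {k} k≢ rewrite dec-false (k ℕ.≟ suc n) k≢ = refl

approx-degree : ∀ f n {k} → n ℕ.< k → approx f n k ≡ 0ℚ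
approx-degree f zero    {suc k} _   = refl
approx-degree f (suc n) {k}     n<k = trans
  (approx-old f n λ { refl → ℕ.<-irrefl refl n<k })
  (approx-degree f n (ℕ.<-trans (ℕ.n<1+n n) n<k))

approx-stable : ∀ f n {k} → k ℕ.≤ n → approx f n k ≡ approx f k k
approx-stable f n k≤n = go (ℕ.≤⇒≤′ k≤n)
  where
  go : ∀ {k n} → k ℕ.≤′ n → approx f n k ≡ approx f k k
  go ℕ.≤′-refl             = refl
  go (ℕ.≤′-step {n} k≤′n) = trans
    (approx-old f n λ { refl → ℕ.<-irrefl refl (ℕ.≤′⇒≤ k≤′n) }) (go k≤′n)

√-constant : ∀ f (f₀ : f 0 ≡ 1ℚ) → √ f [ f₀ ] 0 ≡ 1ℚ
√-constant f f₀ = refl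

√-square : ∀ f (f₀ : f 0 ≡ 1ℚ) → √ f [ f₀ ] * √ f [ f₀ ] ≗ f
√-square f f₀ zero    = sym f₀
√-square f f₀ (suc n) = begin
  (s * s) (suc n)
    ≡⟨ *-ends s s n ⟩
  1ℚ ℚ.* s (suc n) ℚ.+ (inner s s n ℚ.+ s (suc n) ℚ.* 1ℚ)
    ≡⟨ cong₂ (λ c m → 1ℚ ℚ.* c ℚ.+ (m ℚ.+ c ℚ.* 1ℚ)) step
         (inner-cong n λ i≤n → sym (approx-stable f n i≤n)) ⟩
  1ℚ ℚ.* c ℚ.+ (m ℚ.+ c ℚ.* 1ℚ)
    ≡⟨ solve 2 (λ a m →
         let c = con ½ :* (a :- m) in
         con 1ℚ :* c :+ (m :+ c :* con 1ℚ) := a) refl (f (suc n)) m ⟩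
  f (suc n) ∎
  where
  open ≡-Reasoning
  open +-*-Solver
  s = √ f [ f₀ ]
  g = approx f n
  m = inner g g n
  c = ½ ℚ.* (f (suc n) ℚ.- m)

  g² : (g * g) (suc n) ≡ m
  g² = begin
    (g * g) (suc n)
      ≡⟨ *-ends g g n ⟩
    g 0 ℚ.* g (suc n) ℚ.+ (m ℚ.+ g (suc n) ℚ.* g 0)
      ≡⟨ cong (λ z → g 0 ℚ.* z ℚ.+ (m ℚ.+ z ℚ.* g 0)) (approx-degree f n (ℕ.n<1+n n)) ⟩
    g 0 ℚ.* 0ℚ ℚ.+ (m ℚ.+ 0ℚ ℚ.* g 0)
      ≡⟨ solve 2 (λ x m → x :* con 0ℚ :+ (m :+ con 0ℚ :* x) := m) refl (g 0) m ⟩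
    m ∎

  step : s (suc n) ≡ c
  step = trans (approx-new f n) (cong (λ z → ½ ℚ.* (f (suc n) ℚ.- z)) g²)

√-unique : ∀ f (f₀ : f 0 ≡ 1ℚ) g → g 0 ≡ 1ℚ → g * g ≗ f → g ≗ √ f [ f₀ ]
√-unique f f₀ g g₀ g²≗f n = below n ℕ.≤-refl
  where
  s = √ f [ f₀ ]

  -- A coefficient of positive index is determined by the square and the
  -- preceding coefficients.
  solveFor : ∀ h → h 0 ≡ 1ℚ → h * h ≗ f → ∀ n →
             h (suc n) ≡ ½ ℚ.* (f (suc n) ℚ.- inner h h n)
  solveFor h h₀ h²≗f n = begin
    h (suc n)
      ≡⟨ solve 2 (λ c m →
           c := con ½ :* (con 1ℚ :* c :+ (m :+ c :* con 1ℚ) :- m)) refl (h (suc n)) m ⟩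
    ½ ℚ.* (1ℚ ℚ.* h (suc n) ℚ.+ (m ℚ.+ h (suc n) ℚ.* 1ℚ) ℚ.- m)
      ≡⟨ cong (λ z → ½ ℚ.* (z ℚ.* h (suc n) ℚ.+ (m ℚ.+ h (suc n) ℚ.* z) ℚ.- m)) h₀ ⟨
    ½ ℚ.* (h 0 ℚ.* h (suc n) ℚ.+ (m ℚ.+ h (suc n) ℚ.* h 0) ℚ.- m)
      ≡⟨ cong (λ z → ½ ℚ.* (z ℚ.- m)) (trans (sym (*-ends h h n)) (h²≗f (suc n))) ⟩
    ½ ℚ.* (f (suc n) ℚ.- m) ∎
    where
    open ≡-Reasoning
    open +-*-Solver
    m = inner h h n

  below : ∀ n {i} → i ℕ.≤ n → g i ≡ s i
  below n       {zero}  _         = g₀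
  below (suc n) {suc i} (s≤s i≤n) = begin
    g (suc i)
      ≡⟨ solveFor g g₀ g²≗f i ⟩
    ½ ℚ.* (f (suc i) ℚ.- inner g g i)
      ≡⟨ cong (λ z → ½ ℚ.* (f (suc i) ℚ.- z))
           (inner-cong i λ j≤i → below n (ℕ.≤-trans j≤i i≤n)) ⟩
    ½ ℚ.* (f (suc i) ℚ.- inner s s i)
      ≡⟨ solveFor s refl (√-square f f₀) i ⟨
    s (suc i) ∎
    where open ≡-Reasoning

P-rook : Series
P-rook = generatingFunction p-rook

{-# OPTIONS --safe #-}

-- Fix a height h = y − x and count the rook paths that end on the diagonal without
-- passing below it by their first step: taking one unit off that step gives
-- linear recurrences in h. The radical yields β = 2 + 2tβ² − 3tβ, hence, after
-- multiplication by βʰ, a three-term recurrence for the powers of β. Suitable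
-- linear combinations of these powers solve the counting recurrences, which
-- have a unique solution; at h = 0 this solution is β/2. No convolution of path
-- counts is needed.

module Submission where

open import Defs
open import Data.Integer.Base as ℤ using (+_)
import Data.Integer.Properties as ℤ
open import Data.List.Base using (List; []; _∷_; _++_; map; length; foldr; drop)
open import Data.List.Membership.Propositional using (_∈_)
open import Data.List.Membership.Propositional.Properties
  using (∈-map⁺; ∈-map⁻; ∈-++⁺ˡ; ∈-++⁺ʳ; ∈-++⁻)
open import Data.List.Membership.Propositional.Properties.WithK using (unique∧set⇒bag)
open import Data.List.Properties using (length-++; length-map; ∷-injectiveʳ)
open import Data.List.Relation.Binary.BagAndSetEquality using (∼bag⇒↭)
open import Data.List.Relation.Binary.Permutation.Propositional.Properties using (↭-length)
open import Data.List.Relation.Unary.All using (All; []; _∷_)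
open import Data.List.Relation.Unary.AllPairs using ([]; _∷_)
open import Data.List.Relation.Unary.Any using (here)
open import Data.List.Relation.Unary.Unique.Propositional using (Unique)
open import Data.List.Relation.Unary.Unique.Propositional.Properties using (map⁺; ++⁺)
open import Data.List.Scans.Base using (scanl)
open import Data.Nat.Base as ℕ using (ℕ; zero; suc; s≤s; z≤n; nonZero)
import Data.Nat.Properties as ℕ
open import Data.Nat.Tactic.RingSolver using (solve-∀)
open import Data.Product.Base using (_×_; _,_; proj₁; proj₂; ∃-syntax)
open import Data.Rational.Base as ℚ using (ℚ; 0ℚ; 1ℚ; ½)
import Data.Rational.Properties as ℚ
open import Data.Rational.Solver using (module +-*-Solver)
import Data.Rational.Unnormalised.Base as ℚᵘ
import Data.Rational.Unnormalised.Properties as ℚᵘ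
open import Data.Sum.Base using (inj₁; inj₂)
open import Function.Base using (_∘_)
open import Function.Bundles using (mk⇔)
open import Relation.Binary.PropositionalEquality
  using (_≡_; _≗_; refl; sym; trans; cong; cong₂; subst; module ≡-Reasoning)
open import Relation.Nullary using (¬_)

open +-*-Solver using (solve; con; _:+_; _:*_; _:-_; _:=_)

-- Catalan rook paths as returns to the diagonal from a given height.

BelowDiagonal : Point → Set
BelowDiagonal (x , y) = x ℕ.< y ℕ.+ 1

-- Completion h n p: the rook path p leads from height y − x = h to the diagonal,
-- climbs n in total, and never passes below the diagonal.
data Completion : ℕ → ℕ → List Point → Set where
  stop : Completion 0 0 []
  up   : ∀ a {h n p} → Completion (suc a ℕ.+ h) n p →
         Completion h (suc a ℕ.+ n) ((0 , suc a) ∷ p)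
  down : ∀ a {h n p} → Completion h n p →
         Completion (suc a ℕ.+ h) n ((suc a , 0) ∷ p)

completion-steps : ∀ {h n p} → Completion h n p → All RookStep p
completion-steps stop       = []
completion-steps (up a c)   = vertical (s≤s z≤n) ∷ completion-steps c
completion-steps (down a c) = horizontal (s≤s z≤n) ∷ completion-steps c

completion-sum : ∀ {h n p} → Completion h n p → foldr _⊕_ origin p ≡ (h ℕ.+ n , n)
completion-sum stop = refl
completion-sum (up a {h} {n} c) rewrite completion-sum c =
  cong (_, suc a ℕ.+ n) (rearrange a h n)
  where
  rearrange : ∀ a h n → suc a ℕ.+ h ℕ.+ n ≡ h ℕ.+ (suc a ℕ.+ n)
  rearrange = solve-∀
completion-sum (down a {h} {n} c) rewrite completion-sum c =
  cong (_, n) (sym (ℕ.+-assoc (suc a) h n))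

height-up : ∀ a h {x y} → y ≡ x ℕ.+ h → y ℕ.+ a ≡ x ℕ.+ 0 ℕ.+ (a ℕ.+ h)
height-up a h {x} refl = rearrange x a h
  where
  rearrange : ∀ x a h → x ℕ.+ h ℕ.+ a ≡ x ℕ.+ 0 ℕ.+ (a ℕ.+ h)
  rearrange = solve-∀

height-down : ∀ a h {x y} → y ≡ x ℕ.+ (a ℕ.+ h) → y ℕ.+ 0 ≡ x ℕ.+ a ℕ.+ h
height-down a h {x} refl = rearrange x a h
  where
  rearrange : ∀ x a h → x ℕ.+ (a ℕ.+ h) ℕ.+ 0 ≡ x ℕ.+ a ℕ.+ h
  rearrange = solve-∀

completion-below : ∀ {h n p x y} → Completion h n p → y ≡ x ℕ.+ h →
                   All BelowDiagonal (scanl _⊕_ (x , y) p)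
-- The starting point is the first node of any path, so it can be treated before the completion is
-- analysed.
completion-below {h} {x = x} {y} c y≡x+h = start ∷ rest c y≡x+h
  where
  start : x ℕ.< y ℕ.+ 1
  start rewrite y≡x+h | ℕ.+-comm (x ℕ.+ h) 1 = s≤s (ℕ.m≤m+n x h)

  rest : ∀ {h n p x y} → Completion h n p → y ≡ x ℕ.+ h →
         All BelowDiagonal (drop 1 (scanl _⊕_ (x , y) p))
  rest stop               _     = []
  rest (up a {h} c)   y≡x+h = completion-below c (height-up (suc a) h y≡x+h)
  rest (down a {h} c) y≡x+h = completion-below c (height-down (suc a) h y≡x+h)

-- Induction on the path. A vertical step is always admissible; for a horizontal one, the bound at
-- the next node shows that its length is at most the current height. The last hypothesis expresses
-- the return to the diagonal and forces height 0 when the path is empty.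
below-completion : ∀ {h p x y} → All RookStep p → y ≡ x ℕ.+ h →
                   All BelowDiagonal (scanl _⊕_ (x , y) p) →
                   proj₁ (foldr _⊕_ origin p) ≡ h ℕ.+ proj₂ (foldr _⊕_ origin p) →
                   Completion h (proj₂ (foldr _⊕_ origin p)) p
below-completion {h} [] _ _ 0≡h+0 rewrite ℕ.m+n≡0⇒m≡0 h (sym 0≡h+0) = stop
below-completion {h} {_ ∷ p} (vertical {suc a} _ ∷ steps) y≡x+h (_ ∷ below) end =
  up a (below-completion steps (height-up (suc a) h y≡x+h) below
    (trans end (rearrange h a (proj₂ (foldr _⊕_ origin p)))))
  where
  rearrange : ∀ h a n → h ℕ.+ (suc a ℕ.+ n) ≡ suc a ℕ.+ h ℕ.+ n
  rearrange = solve-∀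
below-completion {h} {_ ∷ p} {x} {y} (horizontal {suc a} _ ∷ steps) y≡x+h (_ ∷ below@(next ∷ _)) end =
  -- Abstracting the truncated difference to a variable `h′` lets `h` be replaced by `suc a + h′`,
  -- the index that `down` produces.
  descend (h ℕ.∸ suc a) (ℕ.m+[n∸m]≡n room) y≡x+h end
  where
  n = proj₂ (foldr _⊕_ origin p)

  room : suc a ℕ.≤ h
  room = ℕ.+-cancelˡ-≤ x (suc a) h (ℕ.s≤s⁻¹ (begin
    suc (x ℕ.+ suc a)  ≤⟨ next ⟩
    y ℕ.+ 0 ℕ.+ 1      ≡⟨ cong (ℕ._+ 1) (ℕ.+-identityʳ y) ⟩
    y ℕ.+ 1            ≡⟨ ℕ.+-comm y 1 ⟩
    suc y              ≡⟨ cong suc y≡x+h ⟩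
    suc (x ℕ.+ h)      ∎))
    where open ℕ.≤-Reasoning

  descend : ∀ {h} h′ → suc a ℕ.+ h′ ≡ h → y ≡ x ℕ.+ h →
            suc a ℕ.+ proj₁ (foldr _⊕_ origin p) ≡ h ℕ.+ n →
            Completion h n ((suc a , 0) ∷ p)
  descend h′ refl y≡x+h end = down a
    (below-completion steps (height-down (suc a) h′ y≡x+h) below
      (ℕ.+-cancelˡ-≡ (suc a) _ _ (trans end (ℕ.+-assoc (suc a) h′ n))))

catalan⇒completion : ∀ {n p} → IsCatalanRookPathTo (n , n) p → Completion 0 n p
catalan⇒completion {p = p} ((steps , end) , below) =
  subst (λ q → Completion 0 (proj₂ q) p) end
    (below-completion steps refl below (trans (cong proj₁ end) (sym (cong proj₂ end))))

completion⇒catalan : ∀ {n p} → Completion 0 n p → IsCatalanRookPathTo (n , n) p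
completion⇒catalan c = (completion-steps c , completion-sum c) , completion-below c refl

-- Listing the completions without repetition.

stays : ℕ → ℕ → List (List Point)
stays zero zero = [] ∷ []
stays _    _    = []

-- Completions from height h by first step; ups k and downs k hold those whose
-- first step is longer than k, with h and n measured after its first k units.
completions : ℕ → ℕ → List (List Point)
ups downs   : ℕ → ℕ → ℕ → List (List Point)
completions h n = stays h n ++ ups 0 h n ++ downs 0 h n
ups   k h zero    = []
ups   k h (suc n) = map ((0 , suc k) ∷_) (completions (suc h) n) ++ ups (suc k) (suc h) n
downs k zero    n = []
downs k (suc h) n = map ((suc k , 0) ∷_) (completions h n) ++ downs (suc k) h n

-- Induction on `a`, the excess over the shortest admissible length `k + 1`. Each recursive call
-- moves one unit of the step from `a` to `k` and raises the base height by one.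
∈-ups⁺ : ∀ a k h n {p} → p ∈ completions (suc a ℕ.+ h) n →
         (0 , suc (k ℕ.+ a)) ∷ p ∈ ups k h (suc a ℕ.+ n)
∈-ups⁺ zero    k h n p∈ rewrite ℕ.+-identityʳ k = ∈-++⁺ˡ (∈-map⁺ ((0 , suc k) ∷_) p∈)
∈-ups⁺ (suc a) k h n {p} p∈ rewrite ℕ.+-suc k a =
  ∈-++⁺ʳ (map ((0 , suc k) ∷_) (completions (suc h) (suc a ℕ.+ n)))
    (∈-ups⁺ a (suc k) (suc h) n
      (subst (λ h → p ∈ completions h n) (sym (ℕ.+-suc (suc a) h)) p∈))

∈-downs⁺ : ∀ a k h n {p} → p ∈ completions h n →
           (suc (k ℕ.+ a) , 0) ∷ p ∈ downs k (suc a ℕ.+ h) n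
∈-downs⁺ zero    k h n p∈ rewrite ℕ.+-identityʳ k = ∈-++⁺ˡ (∈-map⁺ ((suc k , 0) ∷_) p∈)
∈-downs⁺ (suc a) k h n p∈ rewrite ℕ.+-suc k a =
  ∈-++⁺ʳ (map ((suc k , 0) ∷_) (completions (suc a ℕ.+ h) n)) (∈-downs⁺ a (suc k) h n p∈)

∈-completions⁺ : ∀ {h n p} → Completion h n p → p ∈ completions h n
∈-completions⁺ stop = here refl
∈-completions⁺ (up a {h} {n} c) =
  ∈-++⁺ʳ (stays h (suc a ℕ.+ n)) (∈-++⁺ˡ (∈-ups⁺ a 0 h n (∈-completions⁺ c)))
∈-completions⁺ (down a {h} {n} c) =
  ∈-++⁺ʳ (stays (suc a ℕ.+ h) n) (∈-++⁺ʳ (ups 0 (suc a ℕ.+ h) n) (∈-downs⁺ a 0 h n (∈-completions⁺ c)))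

∈-ups⁻ : ∀ k h n {p} → p ∈ ups k h n →
         ∃[ a ] ∃[ m ] ∃[ q ] n ≡ suc a ℕ.+ m × p ≡ (0 , suc (k ℕ.+ a)) ∷ q ×
           q ∈ completions (suc a ℕ.+ h) m
∈-ups⁻ k h (suc n) p∈ with ∈-++⁻ (map ((0 , suc k) ∷_) (completions (suc h) n)) p∈
... | inj₁ p∈map with q , q∈ , refl ← ∈-map⁻ _ p∈map =
  0 , n , q , refl , cong (λ j → (0 , suc j) ∷ q) (sym (ℕ.+-identityʳ k)) , q∈
... | inj₂ p∈ups with a , m , q , refl , refl , q∈ ← ∈-ups⁻ (suc k) (suc h) n p∈ups =
  suc a , m , q , refl , cong (λ j → (0 , suc j) ∷ q) (sym (ℕ.+-suc k a)) ,
  subst (λ h → q ∈ completions h m) (ℕ.+-suc (suc a) h) q∈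

∈-downs⁻ : ∀ k h n {p} → p ∈ downs k h n →
           ∃[ a ] ∃[ h′ ] ∃[ q ] h ≡ suc a ℕ.+ h′ × p ≡ (suc (k ℕ.+ a) , 0) ∷ q ×
             q ∈ completions h′ n
∈-downs⁻ k (suc h) n p∈ with ∈-++⁻ (map ((suc k , 0) ∷_) (completions h n)) p∈
... | inj₁ p∈map with q , q∈ , refl ← ∈-map⁻ _ p∈map =
  0 , h , q , refl , cong (λ j → (suc j , 0) ∷ q) (sym (ℕ.+-identityʳ k)) , q∈
... | inj₂ p∈downs with a , h′ , q , refl , refl , q∈ ← ∈-downs⁻ (suc k) h n p∈downs =
  suc a , h′ , q , refl , cong (λ j → (suc j , 0) ∷ q) (sym (ℕ.+-suc k a)) , q∈

∈-stays⁻ : ∀ h n {p} → p ∈ stays h n → h ≡ 0 × n ≡ 0 × p ≡ []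
∈-stays⁻ zero zero (here refl) = refl , refl , refl

-- Induction on the path. Neither `h` nor `n` decreases in every case: an upward step raises `h`,
-- and a downward step keeps `n`.
∈-completions⁻ : ∀ p h n → p ∈ completions h n → Completion h n p
∈-completions⁻ p h n p∈ with ∈-++⁻ (stays h n) p∈
... | inj₁ p∈stays with refl , refl , refl ← ∈-stays⁻ h n p∈stays = stop
... | inj₂ p∈moves with ∈-++⁻ (ups 0 h n) p∈moves
...   | inj₁ p∈ups with a , m , q , refl , refl , q∈ ← ∈-ups⁻ 0 h n p∈ups =
  up a (∈-completions⁻ q (suc a ℕ.+ h) m q∈)
...   | inj₂ p∈downs with a , h′ , q , refl , refl , q∈ ← ∈-downs⁻ 0 h n p∈downs =
  down a (∈-completions⁻ q h′ n q∈)

-- The first step of a path, or its absence, tells which of the three blocks contains it; inside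
-- `ups` and `downs` the length of that step tells which summand does.
completions-unique : ∀ h n → Unique (completions h n)
ups-unique   : ∀ k h n → Unique (ups k h n)
downs-unique : ∀ k h n → Unique (downs k h n)

completions-unique h n = ++⁺ (stays-unique h n)
  (++⁺ (ups-unique 0 h n) (downs-unique 0 h n) up≢down)
  stay≢move
  where
  stays-unique : ∀ h n → Unique (stays h n)
  stays-unique zero    zero    = [] ∷ []
  stays-unique zero    (suc n) = []
  stays-unique (suc h) n       = []

  up≢down : ∀ {p} → ¬ (p ∈ ups 0 h n × p ∈ downs 0 h n)
  up≢down (p∈ups , p∈downs)
    with _ , _ , _ , _ , refl , _ ← ∈-ups⁻ 0 h n p∈ups
       | _ , _ , _ , _ , () , _ ← ∈-downs⁻ 0 h n p∈downs

  stay≢move : ∀ {p} → ¬ (p ∈ stays h n × p ∈ ups 0 h n ++ downs 0 h n)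
  stay≢move (p∈stays , p∈moves)
    with _ , _ , refl ← ∈-stays⁻ h n p∈stays | ∈-++⁻ (ups 0 h n) p∈moves
  ... | inj₁ p∈ups   with _ , _ , _ , _ , () , _ ← ∈-ups⁻ 0 h n p∈ups
  ... | inj₂ p∈downs with _ , _ , _ , _ , () , _ ← ∈-downs⁻ 0 h n p∈downs

ups-unique k h zero    = []
ups-unique k h (suc n) =
  ++⁺ (map⁺ ∷-injectiveʳ (completions-unique (suc h) n)) (ups-unique (suc k) (suc h) n) disjoint
  where
  disjoint : ∀ {p} → ¬ (p ∈ map ((0 , suc k) ∷_) (completions (suc h) n) ×
                        p ∈ ups (suc k) (suc h) n)
  disjoint (p∈map , p∈ups)
    with _ , _ , refl ← ∈-map⁻ _ p∈map
       | _ , _ , _ , _ , eq , _ ← ∈-ups⁻ (suc k) (suc h) n p∈ups =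
    -- The same first step would have length `k + 1` and length at least `k + 2`. The value on the
    -- empty list is a dummy.
    ℕ.m≢1+m+n k (ℕ.suc-injective (cong (λ { ((_ , y) ∷ _) → y ; [] → 0 }) eq))

downs-unique k zero    n = []
downs-unique k (suc h) n =
  ++⁺ (map⁺ ∷-injectiveʳ (completions-unique h n)) (downs-unique (suc k) h n) disjoint
  where
  disjoint : ∀ {p} → ¬ (p ∈ map ((suc k , 0) ∷_) (completions h n) × p ∈ downs (suc k) h n)
  disjoint (p∈map , p∈downs)
    with _ , _ , refl ← ∈-map⁻ _ p∈map
       | _ , _ , _ , _ , eq , _ ← ∈-downs⁻ (suc k) h n p∈downs =
    ℕ.m≢1+m+n k (ℕ.suc-injective (cong (λ { ((x , _) ∷ _) → x ; [] → 0 }) eq))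

-- Two lists without repetition that have the same elements are permutations of each other.
p-rook≡length : ∀ n → p-rook n ≡ length (completions 0 n)
p-rook≡length n = ↭-length (∼bag⇒↭ (unique∧set⇒bag unique (completions-unique 0 n)
  (mk⇔ (λ p∈ → ∈-completions⁺ (catalan⇒completion (sound p∈)))
       (λ p∈ → complete (completion⇒catalan (∈-completions⁻ _ 0 n p∈))))))
  where open Enumeration (catalanRookPaths (n , n))

-- Formal power series

[_] : ℕ → ℚ
[ n ] = + n ℚ./ 1

-- Reduction to lowest terms does not evaluate for a variable numerator, so the identity is checked
-- on unnormalised fractions.
[]-homo-+ : ∀ m n → [ m ℕ.+ n ] ≡ [ m ] ℚ.+ [ n ]
[]-homo-+ m n = ℚ.toℚᵘ-injective (begin
  ℚ.toℚᵘ [ m ℕ.+ n ]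
    ≈⟨ ℚ.toℚᵘ-fromℚᵘ (ℚᵘ.mkℚᵘ (+ (m ℕ.+ n)) 0) ⟩
  ℚᵘ.mkℚᵘ (+ (m ℕ.+ n)) 0
    ≈⟨ ℚᵘ.*≡* (cong (ℤ._* + 1)
         (cong₂ ℤ._+_ (ℤ.*-identityʳ (+ m)) (ℤ.*-identityʳ (+ n)))) ⟨
  ℚᵘ.mkℚᵘ (+ m) 0 ℚᵘ.+ ℚᵘ.mkℚᵘ (+ n) 0
    ≈⟨ ℚᵘ.+-cong (ℚ.toℚᵘ-fromℚᵘ (ℚᵘ.mkℚᵘ (+ m) 0)) (ℚ.toℚᵘ-fromℚᵘ (ℚᵘ.mkℚᵘ (+ n) 0)) ⟨
  ℚ.toℚᵘ [ m ] ℚᵘ.+ ℚ.toℚᵘ [ n ]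
    ≈⟨ ℚ.toℚᵘ-homo-+ [ m ] [ n ] ⟨
  ℚ.toℚᵘ ([ m ] ℚ.+ [ n ]) ∎)
  where open ℚᵘ.≃-Reasoning

open ≡-Reasoning

*-identityˡ : ∀ f → constant 1 * f ≗ f
*-identityˡ f n = trans (constant-* 1 f n) (ℚ.*-identityˡ (f n))

-- At index `suc n` the convolution unfolds by computation to `f 0` times the last coefficient of
-- the second factor plus the coefficient at `n` of the product with `f ∘ suc`. The inductions on
-- products below rest on this as well.
*-identityʳ : ∀ f → f * constant 1 ≗ f
*-identityʳ f zero    = solve 1 (λ x → x :* con 1ℚ :+ con 0ℚ := x) refl (f 0)
*-identityʳ f (suc n) = trans
  (cong (f 0 ℚ.* 0ℚ ℚ.+_) (*-identityʳ (f ∘ suc) n))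
  (solve 2 (λ x y → x :* con 0ℚ :+ y := y) refl (f 0) (f (suc n)))

*-congʳ : ∀ f {g h} → g ≗ h → f * g ≗ f * h
*-congʳ f g≗h n = *-cong-≤ {f} {f} n (λ _ → refl) (λ {i} _ → g≗h i)

*-congˡ : ∀ {f g} h → f ≗ g → f * h ≗ g * h
*-congˡ h f≗g n = *-cong-≤ {g = h} {h} n (λ {i} _ → f≗g i) (λ _ → refl)

t-*-assoc : ∀ f g → (t * f) * g ≗ t * (f * g)
t-*-assoc f g zero    = begin
  (t * f) 0 ℚ.* g 0 ℚ.+ 0ℚ  ≡⟨ cong (λ x → x ℚ.* g 0 ℚ.+ 0ℚ) (t-*-zero f) ⟩
  0ℚ ℚ.* g 0 ℚ.+ 0ℚ         ≡⟨ t-*-zero g ⟩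
  0ℚ                        ≡⟨ t-*-zero (f * g) ⟨
  (t * (f * g)) 0           ∎
t-*-assoc f g (suc n) = begin
  (t * f) 0 ℚ.* g (suc n) ℚ.+ (((t * f) ∘ suc) * g) n
    ≡⟨ cong₂ (λ x y → x ℚ.* g (suc n) ℚ.+ y) (t-*-zero f) (*-congˡ g (t-*-suc f) n) ⟩
  0ℚ ℚ.* g (suc n) ℚ.+ (f * g) n
    ≡⟨ solve 2 (λ x y → con 0ℚ :* x :+ y := y) refl (g (suc n)) ((f * g) n) ⟩
  (f * g) n
    ≡⟨ t-*-suc (f * g) n ⟨
  (t * (f * g)) (suc n) ∎

*-t-assoc : ∀ f g → f * (t * g) ≗ t * (f * g)
*-t-assoc f g zero    = begin
  f 0 ℚ.* (t * g) 0 ℚ.+ 0ℚ  ≡⟨ cong (λ x → f 0 ℚ.* x ℚ.+ 0ℚ) (t-*-zero g) ⟩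
  f 0 ℚ.* 0ℚ ℚ.+ 0ℚ         ≡⟨ solve 1 (λ x → x :* con 0ℚ :+ con 0ℚ := con 0ℚ) refl (f 0) ⟩
  0ℚ                        ≡⟨ t-*-zero (f * g) ⟨
  (t * (f * g)) 0           ∎
*-t-assoc f g (suc n) = begin
  f 0 ℚ.* (t * g) (suc n) ℚ.+ ((f ∘ suc) * (t * g)) n
    ≡⟨ cong₂ (λ x y → f 0 ℚ.* x ℚ.+ y) (t-*-suc g n) (*-t-assoc (f ∘ suc) g n) ⟩
  f 0 ℚ.* g n ℚ.+ (t * ((f ∘ suc) * g)) n
    ≡⟨ head+tail n ⟩
  (f * g) n
    ≡⟨ t-*-suc (f * g) n ⟨
  (t * (f * g)) (suc n) ∎
  where
  -- Undoes the unfolding of the convolution: the factor `t` supplies the index shift, and makes the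
  -- tail vanish at index 0.
  head+tail : ∀ n → f 0 ℚ.* g n ℚ.+ (t * ((f ∘ suc) * g)) n ≡ (f * g) n
  head+tail zero    = cong (f 0 ℚ.* g 0 ℚ.+_) (t-*-zero ((f ∘ suc) * g))
  head+tail (suc n) = cong (f 0 ℚ.* g (suc n) ℚ.+_) (t-*-suc ((f ∘ suc) * g) n)

-- The identities for the radical, for β and for its powers all have three terms, so linearity of
-- the product in this one shape covers them.
combination : ℚ → Series → ℚ → Series → ℚ → Series → Series
combination a f b g c h n = a ℚ.* f n ℚ.+ b ℚ.* g n ℚ.+ c ℚ.* h n

module _ (a b c : ℚ) where

  combination-cong : ∀ {f f′ g g′ h h′} → f ≗ f′ → g ≗ g′ → h ≗ h′ →
                     combination a f b g c h ≗ combination a f′ b g′ c h′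
  combination-cong f≗f′ g≗g′ h≗h′ n = cong₂ ℚ._+_
    (cong₂ ℚ._+_ (cong (a ℚ.*_) (f≗f′ n)) (cong (b ℚ.*_) (g≗g′ n)))
    (cong (c ℚ.*_) (h≗h′ n))

  *-combination : ∀ k f g h → k * combination a f b g c h ≗
                              combination a (k * f) b (k * g) c (k * h)
  *-combination k f g h zero =
    solve 7 (λ a b c x f g h → x :* (a :* f :+ b :* g :+ c :* h) :+ con 0ℚ :=
              a :* (x :* f :+ con 0ℚ) :+ b :* (x :* g :+ con 0ℚ) :+ c :* (x :* h :+ con 0ℚ))
      refl a b c (k 0) (f 0) (g 0) (h 0)
  *-combination k f g h (suc n) = trans
    (cong (k 0 ℚ.* combination a f b g c h (suc n) ℚ.+_) (*-combination (k ∘ suc) f g h n))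
    (solve 10 (λ a b c x f g h p q r →
        x :* (a :* f :+ b :* g :+ c :* h) :+ (a :* p :+ b :* q :+ c :* r) :=
        a :* (x :* f :+ p) :+ b :* (x :* g :+ q) :+ c :* (x :* h :+ r))
      refl a b c (k 0) (f (suc n)) (g (suc n)) (h (suc n))
      (((k ∘ suc) * f) n) (((k ∘ suc) * g) n) (((k ∘ suc) * h) n))

  combination-* : ∀ f g h k → combination a f b g c h * k ≗
                              combination a (f * k) b (g * k) c (h * k)
  combination-* f g h k zero =
    solve 7 (λ a b c x f g h → (a :* f :+ b :* g :+ c :* h) :* x :+ con 0ℚ :=
              a :* (f :* x :+ con 0ℚ) :+ b :* (g :* x :+ con 0ℚ) :+ c :* (h :* x :+ con 0ℚ))
      refl a b c (k 0) (f 0) (g 0) (h 0)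
  combination-* f g h k (suc n) = trans
    (cong (combination a f b g c h 0 ℚ.* k (suc n) ℚ.+_)
      (combination-* (f ∘ suc) (g ∘ suc) (h ∘ suc) k n))
    (solve 10 (λ a b c x f g h p q r →
        (a :* f :+ b :* g :+ c :* h) :* x :+ (a :* p :+ b :* q :+ c :* r) :=
        a :* (f :* x :+ p) :+ b :* (g :* x :+ q) :+ c :* (h :* x :+ r))
      refl a b c (k (suc n)) (f 0) (g 0) (h 0)
      (((f ∘ suc) * k) n) (((g ∘ suc) * k) n) (((h ∘ suc) * k) n))

-- The quadratic equation for β.

[-3] [-4] : ℚ
[-3] = ℚ.- [ 3 ]
[-4] = ℚ.- [ 4 ]

-- Gives the linear term the form of `t` times a series, to which the shift rule `t-*-suc` and the
-- rules for pulling out `t` apply.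
t≗t*1 : t ≗ t * constant 1
t≗t*1 n = sym (*-identityʳ t n)

-- s = 1 + 3t − 4tβ and s² = 1 − 10t + 9t² give β = 2 + 2tβ² − 3tβ.
module _ (s β : Series)
  (s≗ : s ≗ combination 1ℚ (constant 1) [ 3 ] (t * constant 1) [-4] (t * β))
  (s² : s * s ≗ constant 1 - constant 10 * t + constant 9 * (t * t)) where

  quadratic : β ≗ combination [ 2 ] (constant 1) [ 2 ] (t * (β * β)) [-3] (t * β)
  quadratic n = begin
    β n
      -- As series, s² minus the radicand equals 8t times the difference of the right-hand side and
      -- β. Its coefficient at `suc n` is thus eight times that difference at `n`, whence the factor
      -- 1/8.
      ≡⟨ solve 5 (λ d T β X Y → β :=
           con [ 2 ] :* d :+ con [ 2 ] :* Y :+ con [-3] :* X :-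
           con (+ 1 ℚ./ 8) :*
             ((con 1ℚ :* (con 1ℚ :* con 0ℚ :+ con [ 3 ] :* d :+ con [-4] :* β)
               :+ con [ 3 ] :* (con 1ℚ :* d :+ con [ 3 ] :* T :+ con [-4] :* X)
               :+ con [-4] :* (con 1ℚ :* β :+ con [ 3 ] :* X :+ con [-4] :* Y))
              :- (con 0ℚ :- con [ 10 ] :* d :+ con [ 9 ] :* T)))
           refl (constant 1 n) ((t * constant 1) n) (β n) ((t * β) n) ((t * (β * β)) n) ⟩
    root ℚ.- (+ 1 ℚ./ 8) ℚ.* (lhs ℚ.- rhs)
      ≡⟨ cong (λ x → root ℚ.- (+ 1 ℚ./ 8) ℚ.* (x ℚ.- rhs))
           (trans (sym s²-expanded) (trans (s² (suc n)) radicand)) ⟩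
    root ℚ.- (+ 1 ℚ./ 8) ℚ.* (rhs ℚ.- rhs)
      ≡⟨ solve 2 (λ x y → x :- con (+ 1 ℚ./ 8) :* (y :- y) := x) refl root rhs ⟩
    root ∎
    where
    root = combination [ 2 ] (constant 1) [ 2 ] (t * (β * β)) [-3] (t * β) n
    s-suc = 1ℚ ℚ.* 0ℚ ℚ.+ [ 3 ] ℚ.* constant 1 n ℚ.+ [-4] ℚ.* β n
    sβ = combination 1ℚ β [ 3 ] (t * β) [-4] (t * (β * β)) n
    -- Expanding the second factor of `s * s` leaves the coefficients of `s` at `suc n`, of `s` at
    -- `n` and of `s * β` at `n`; each is then expanded in turn.
    lhs = 1ℚ ℚ.* s-suc
          ℚ.+ [ 3 ] ℚ.* combination 1ℚ (constant 1) [ 3 ] (t * constant 1) [-4] (t * β) n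
          ℚ.+ [-4] ℚ.* sβ
    rhs = 0ℚ ℚ.- [ 10 ] ℚ.* constant 1 n ℚ.+ [ 9 ] ℚ.* (t * constant 1) n

    s≡s-suc : s (suc n) ≡ s-suc
    s≡s-suc = trans (s≗ (suc n)) (cong₂ (λ x y → 1ℚ ℚ.* 0ℚ ℚ.+ [ 3 ] ℚ.* x ℚ.+ [-4] ℚ.* y)
      (t-*-suc (constant 1) n) (t-*-suc β n))

    s*β : (s * β) n ≡ sβ
    s*β = begin
      (s * β) n
        ≡⟨ *-congˡ β s≗ n ⟩
      (combination 1ℚ (constant 1) [ 3 ] (t * constant 1) [-4] (t * β) * β) n
        ≡⟨ combination-* 1ℚ [ 3 ] [-4] (constant 1) (t * constant 1) (t * β) β n ⟩
      combination 1ℚ (constant 1 * β) [ 3 ] (t * constant 1 * β) [-4] (t * β * β) n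
        ≡⟨ combination-cong 1ℚ [ 3 ] [-4] (*-identityˡ β)
             (*-congˡ β (*-identityʳ t)) (t-*-assoc β β) n ⟩
      sβ ∎

    s²-expanded : (s * s) (suc n) ≡ lhs
    s²-expanded = begin
      (s * s) (suc n)
        ≡⟨ *-congʳ s s≗ (suc n) ⟩
      (s * combination 1ℚ (constant 1) [ 3 ] (t * constant 1) [-4] (t * β)) (suc n)
        ≡⟨ *-combination 1ℚ [ 3 ] [-4] s (constant 1) (t * constant 1) (t * β) (suc n) ⟩
      combination 1ℚ (s * constant 1) [ 3 ] (s * (t * constant 1)) [-4] (s * (t * β)) (suc n)
        ≡⟨ combination-cong 1ℚ [ 3 ] [-4] (*-identityʳ s)
             (*-t-assoc s (constant 1)) (*-t-assoc s β) (suc n) ⟩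
      combination 1ℚ s [ 3 ] (t * (s * constant 1)) [-4] (t * (s * β)) (suc n)
        ≡⟨ cong₂ (λ x y → 1ℚ ℚ.* s (suc n) ℚ.+ [ 3 ] ℚ.* x ℚ.+ [-4] ℚ.* y)
             (t-*-suc (s * constant 1) n) (t-*-suc (s * β) n) ⟩
      1ℚ ℚ.* s (suc n) ℚ.+ [ 3 ] ℚ.* (s * constant 1) n ℚ.+ [-4] ℚ.* (s * β) n
        ≡⟨ cong₂ ℚ._+_
             (cong₂ (λ x y → 1ℚ ℚ.* x ℚ.+ [ 3 ] ℚ.* y) s≡s-suc
               (trans (*-identityʳ s n) (s≗ n)))
             (cong ([-4] ℚ.*_) s*β) ⟩
      lhs ∎

    radicand : (constant 1 - constant 10 * t + constant 9 * (t * t)) (suc n) ≡ rhs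
    radicand = cong₂ (λ x y → 0ℚ ℚ.- x ℚ.+ y)
      (trans (constant-* 10 t (suc n))
        (cong ([ 10 ] ℚ.*_) (trans (t≗t*1 (suc n)) (t-*-suc (constant 1) n))))
      (trans (constant-* 9 (t * t) (suc n))
        (cong ([ 9 ] ℚ.*_) (trans (t-*-suc t n) (t≗t*1 n))))

-- Powers of β and the numbers of completions.

[length-++] : ∀ {A : Set} (xs ys : List A) → [ length (xs ++ ys) ] ≡ [ length xs ] ℚ.+ [ length ys ]
[length-++] xs ys = trans (cong [_] (length-++ xs)) ([]-homo-+ (length xs) (length ys))

module _ (β : Series)
  (quadratic : β ≗ combination [ 2 ] (constant 1) [ 2 ] (t * (β * β)) [-3] (t * β)) where

  power : ℕ → Series
  power zero    = constant 1
  power (suc h) = β * power h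

  power-recurrence : ∀ h → power (suc h) ≗
    combination [ 2 ] (power h) [ 2 ] (t * power (2 ℕ.+ h)) [-3] (t * power (1 ℕ.+ h))
  power-recurrence zero n = begin
    (β * constant 1) n
      ≡⟨ *-identityʳ β n ⟩
    β n
      ≡⟨ quadratic n ⟩
    combination [ 2 ] (constant 1) [ 2 ] (t * (β * β)) [-3] (t * β) n
      ≡⟨ combination-cong [ 2 ] [ 2 ] [-3] {f = constant 1} (λ _ → refl)
           (*-congʳ t (*-congʳ β λ k → sym (*-identityʳ β k)))
           (*-congʳ t λ k → sym (*-identityʳ β k)) n ⟩
    combination [ 2 ] (power 0) [ 2 ] (t * power 2) [-3] (t * power 1) n ∎
  power-recurrence (suc h) n = begin
    (β * power (suc h)) n
      ≡⟨ *-congʳ β (power-recurrence h) n ⟩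
    (β * combination [ 2 ] (power h) [ 2 ] (t * power (2 ℕ.+ h)) [-3] (t * power (1 ℕ.+ h))) n
      ≡⟨ *-combination [ 2 ] [ 2 ] [-3] β (power h) (t * power (2 ℕ.+ h)) (t * power (1 ℕ.+ h)) n ⟩
    combination [ 2 ] (β * power h) [ 2 ] (β * (t * power (2 ℕ.+ h)))
      [-3] (β * (t * power (1 ℕ.+ h))) n
      ≡⟨ combination-cong [ 2 ] [ 2 ] [-3] {f = β * power h} (λ _ → refl)
           (*-t-assoc β (power (2 ℕ.+ h))) (*-t-assoc β (power (1 ℕ.+ h))) n ⟩
    combination [ 2 ] (power (1 ℕ.+ h)) [ 2 ] (t * power (3 ℕ.+ h))
      [-3] (t * power (2 ℕ.+ h)) n ∎

  -- ½βʰ⁺¹ and t · upward h count the completions whose first step is down from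
  -- height h + 1, respectively up from height h.
  upward : ℕ → Series
  upward h n = ½ ℚ.* ([ 2 ] ℚ.* power (2 ℕ.+ h) n ℚ.+ [-3] ℚ.* power (1 ℕ.+ h) n)

  -- Half of `power-recurrence`. For positive `h` it matches a decomposition: a first step down from
  -- `h + 1` has one unit, followed by any completion from `h`, or is longer and becomes a first
  -- step down from `h` when a unit is removed. For `h = 0` the term 1 accounts for the empty
  -- completion.
  half-recurrence : ∀ h n → ½ ℚ.* power (suc h) n ≡ power h n ℚ.+ (t * upward h) n
  half-recurrence h n = trans (cong (½ ℚ.*_) (power-recurrence h n)) (go n)
    where
    go : ∀ n → ½ ℚ.* combination [ 2 ] (power h) [ 2 ] (t * power (2 ℕ.+ h))
                         [-3] (t * power (1 ℕ.+ h)) n ≡ power h n ℚ.+ (t * upward h) n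
    go zero = begin
      ½ ℚ.* ([ 2 ] ℚ.* power h 0 ℚ.+ [ 2 ] ℚ.* (t * power (2 ℕ.+ h)) 0
             ℚ.+ [-3] ℚ.* (t * power (1 ℕ.+ h)) 0)
        ≡⟨ cong₂ (λ x y → ½ ℚ.* ([ 2 ] ℚ.* power h 0 ℚ.+ [ 2 ] ℚ.* x ℚ.+ [-3] ℚ.* y))
             (t-*-zero (power (2 ℕ.+ h))) (t-*-zero (power (1 ℕ.+ h))) ⟩
      ½ ℚ.* ([ 2 ] ℚ.* power h 0 ℚ.+ [ 2 ] ℚ.* 0ℚ ℚ.+ [-3] ℚ.* 0ℚ)
        ≡⟨ solve 1 (λ x → con ½ :* (con [ 2 ] :* x :+ con [ 2 ] :* con 0ℚ :+ con [-3] :* con 0ℚ)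
             := x :+ con 0ℚ) refl (power h 0) ⟩
      power h 0 ℚ.+ 0ℚ
        ≡⟨ cong (power h 0 ℚ.+_) (t-*-zero (upward h)) ⟨
      power h 0 ℚ.+ (t * upward h) 0 ∎
    go (suc n) = begin
      ½ ℚ.* ([ 2 ] ℚ.* power h (suc n) ℚ.+ [ 2 ] ℚ.* (t * power (2 ℕ.+ h)) (suc n)
             ℚ.+ [-3] ℚ.* (t * power (1 ℕ.+ h)) (suc n))
        ≡⟨ cong₂ (λ x y → ½ ℚ.* ([ 2 ] ℚ.* power h (suc n) ℚ.+ [ 2 ] ℚ.* x ℚ.+ [-3] ℚ.* y))
             (t-*-suc (power (2 ℕ.+ h)) n) (t-*-suc (power (1 ℕ.+ h)) n) ⟩
      ½ ℚ.* ([ 2 ] ℚ.* power h (suc n) ℚ.+ [ 2 ] ℚ.* power (2 ℕ.+ h) n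
             ℚ.+ [-3] ℚ.* power (1 ℕ.+ h) n)
        ≡⟨ solve 3 (λ x y z → con ½ :* (con [ 2 ] :* x :+ con [ 2 ] :* y :+ con [-3] :* z) :=
             x :+ con ½ :* (con [ 2 ] :* y :+ con [-3] :* z))
             refl (power h (suc n)) (power (2 ℕ.+ h) n) (power (1 ℕ.+ h) n) ⟩
      power h (suc n) ℚ.+ upward h n
        ≡⟨ cong (power h (suc n) ℚ.+_) (t-*-suc (upward h) n) ⟨
      power h (suc n) ℚ.+ (t * upward h) (suc n) ∎

  -- The analogue for first steps up: the first two terms count the completions from `h + 1` that
  -- follow a unit step, the last term those whose first step is longer.
  upward-recurrence : ∀ h n → upward h n ≡
    (t * upward (suc h)) n ℚ.+ ½ ℚ.* power (suc h) n ℚ.+ (t * upward (suc h)) n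
  upward-recurrence h n = begin
    ½ ℚ.* ([ 2 ] ℚ.* power (2 ℕ.+ h) n ℚ.+ [-3] ℚ.* power (1 ℕ.+ h) n)
      -- The higher power is written as twice its half to expose the left side of `half-recurrence`
      -- at `suc h`.
      ≡⟨ solve 2 (λ x y → con ½ :* (con [ 2 ] :* x :+ con [-3] :* y) :=
           con [ 2 ] :* (con ½ :* x) :- con ½ :* y :- y)
           refl (power (2 ℕ.+ h) n) (power (1 ℕ.+ h) n) ⟩
    [ 2 ] ℚ.* (½ ℚ.* power (2 ℕ.+ h) n) ℚ.- ½ ℚ.* power (1 ℕ.+ h) n ℚ.- power (1 ℕ.+ h) n
      ≡⟨ cong (λ x → [ 2 ] ℚ.* x ℚ.- ½ ℚ.* power (1 ℕ.+ h) n ℚ.- power (1 ℕ.+ h) n)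
           (half-recurrence (suc h) n) ⟩
    [ 2 ] ℚ.* (power (1 ℕ.+ h) n ℚ.+ (t * upward (suc h)) n)
      ℚ.- ½ ℚ.* power (1 ℕ.+ h) n ℚ.- power (1 ℕ.+ h) n
      ≡⟨ solve 2 (λ y u → con [ 2 ] :* (y :+ u) :- con ½ :* y :- y := u :+ con ½ :* y :+ u)
           refl (power (1 ℕ.+ h) n) ((t * upward (suc h)) n) ⟩
    (t * upward (suc h)) n ℚ.+ ½ ℚ.* power (suc h) n ℚ.+ (t * upward (suc h)) n ∎

  -- Simultaneous induction along the definition of the lists. The offset `k` affects only the label
  -- of the first step, so the counts are independent of it.
  completions-suc-length : ∀ h n → [ length (completions (suc h) n) ] ≡
                           (t * upward (suc h)) n ℚ.+ ½ ℚ.* power (suc h) n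
  ups-length   : ∀ k h n → [ length (ups k h n) ] ≡ (t * upward h) n
  downs-length : ∀ k h n → [ length (downs k (suc h) n) ] ≡ ½ ℚ.* power (suc h) n
  completions-zero-length : ∀ n → [ length (completions 0 n) ] ≡ ½ ℚ.* power 1 n

  completions-suc-length h n = trans ([length-++] (ups 0 (suc h) n) (downs 0 (suc h) n))
    (cong₂ ℚ._+_ (ups-length 0 (suc h) n) (downs-length 0 h n))

  completions-zero-length n = begin
    [ length (stays 0 n ++ ups 0 0 n ++ []) ]
      ≡⟨ [length-++] (stays 0 n) (ups 0 0 n ++ []) ⟩
    [ length (stays 0 n) ] ℚ.+ [ length (ups 0 0 n ++ []) ]
      ≡⟨ cong₂ ℚ._+_ (stays-length n) ([length-++] (ups 0 0 n) []) ⟩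
    constant 1 n ℚ.+ ([ length (ups 0 0 n) ] ℚ.+ 0ℚ)
      ≡⟨ cong (constant 1 n ℚ.+_) (trans (ℚ.+-identityʳ _) (ups-length 0 0 n)) ⟩
    constant 1 n ℚ.+ (t * upward 0) n
      ≡⟨ half-recurrence 0 n ⟨
    ½ ℚ.* power 1 n ∎
    where
    stays-length : ∀ n → [ length (stays 0 n) ] ≡ constant 1 n
    stays-length zero    = refl
    stays-length (suc n) = refl

  ups-length k h zero    = sym (t-*-zero (upward h))
  ups-length k h (suc n) = begin
    [ length (map ((0 , suc k) ∷_) (completions (suc h) n) ++ ups (suc k) (suc h) n) ]
      ≡⟨ [length-++] (map _ (completions (suc h) n)) _ ⟩
    [ length (map ((0 , suc k) ∷_) (completions (suc h) n)) ] ℚ.+ [ length (ups (suc k) (suc h) n) ]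
      ≡⟨ cong₂ ℚ._+_
           (trans (cong [_] (length-map _ (completions (suc h) n))) (completions-suc-length h n))
           (ups-length (suc k) (suc h) n) ⟩
    (t * upward (suc h)) n ℚ.+ ½ ℚ.* power (suc h) n ℚ.+ (t * upward (suc h)) n
      ≡⟨ upward-recurrence h n ⟨
    upward h n
      ≡⟨ t-*-suc (upward h) n ⟨
    (t * upward h) (suc n) ∎

  downs-length k zero n = begin
    [ length (map ((suc k , 0) ∷_) (completions 0 n) ++ []) ]
      ≡⟨ [length-++] (map ((suc k , 0) ∷_) (completions 0 n)) [] ⟩
    [ length (map ((suc k , 0) ∷_) (completions 0 n)) ] ℚ.+ 0ℚ
      ≡⟨ ℚ.+-identityʳ _ ⟩
    [ length (map ((suc k , 0) ∷_) (completions 0 n)) ]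
      ≡⟨ cong [_] (length-map _ (completions 0 n)) ⟩
    [ length (completions 0 n) ]
      ≡⟨ completions-zero-length n ⟩
    ½ ℚ.* power 1 n ∎
  downs-length k (suc h) n = begin
    [ length (map ((suc k , 0) ∷_) (completions (suc h) n) ++ downs (suc k) (suc h) n) ]
      ≡⟨ [length-++] (map _ (completions (suc h) n)) _ ⟩
    [ length (map ((suc k , 0) ∷_) (completions (suc h) n)) ] ℚ.+ [ length (downs (suc k) (suc h) n) ]
      ≡⟨ cong₂ ℚ._+_
           (trans (cong [_] (length-map _ (completions (suc h) n))) (completions-suc-length h n))
           (downs-length (suc k) h n) ⟩
    (t * upward (suc h)) n ℚ.+ ½ ℚ.* power (suc h) n ℚ.+ ½ ℚ.* power (suc h) n
      ≡⟨ solve 2 (λ u y → u :+ con ½ :* y :+ con ½ :* y := y :+ u)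
           refl ((t * upward (suc h)) n) (power (suc h) n) ⟩
    power (suc h) n ℚ.+ (t * upward (suc h)) n
      ≡⟨ half-recurrence (suc h) n ⟨
    ½ ℚ.* power (2 ℕ.+ h) n ∎

  P-rook≗half : ∀ n → P-rook n ≡ ½ ℚ.* β n
  P-rook≗half n = begin
    [ p-rook n ]                  ≡⟨ cong [_] (p-rook≡length n) ⟩
    [ length (completions 0 n) ]  ≡⟨ completions-zero-length n ⟩
    ½ ℚ.* (β * constant 1) n      ≡⟨ cong (½ ℚ.*_) (*-identityʳ β n) ⟩
    ½ ℚ.* β n                     ∎

-- The closed form of the generating function.

theorem3p1 :
  let radical   = √ constant 1 - constant 10 * t + constant 9 * (t * t) [ refl ]
      numerator = constant 1 + constant 3 * t - radical
      β         = numerator / 4 t[ refl ]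
  in (P-rook ≗ numerator / 8 t[ refl ]) × (numerator / 8 t[ refl ] ≗ β ÷ 2)
theorem3p1 = (λ n → trans (P-rook≗half β β-quadratic n) (trans (ℚ.*-comm ½ (β n)) (sym (halve n)))) , halve
  where
  radicand radical numerator β : Series
  radicand  = constant 1 - constant 10 * t + constant 9 * (t * t)
  radical   = √ radicand [ refl ]
  numerator = constant 1 + constant 3 * t - radical
  β         = numerator / 4 t[ refl ]

  halve : numerator / 8 t[ refl ] ≗ β ÷ 2
  -- The product of 1/4 and ½ evaluates to 1/8.
  halve n = sym (ℚ.*-assoc (numerator (suc n)) (+ 1 ℚ./ 4) ½)

  radical≗ : radical ≗ combination 1ℚ (constant 1) [ 3 ] (t * constant 1) [-4] (t * β)
  radical≗ n = begin
    radical n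
      -- Introduces the numerator, which is then replaced by 4tβ.
      ≡⟨ solve 2 (λ x r → r := x :- (x :- r)) refl (linear n) (radical n) ⟩
    linear n ℚ.- numerator n
      ≡⟨ cong (λ x → linear n ℚ.- x) (trans (sym (/t-correct numerator 4 refl n)) (constant-* 4 (t * β) n)) ⟩
    linear n ℚ.- [ 4 ] ℚ.* (t * β) n
      ≡⟨ cong (λ x → constant 1 n ℚ.+ x ℚ.- [ 4 ] ℚ.* (t * β) n)
           (trans (constant-* 3 t n) (cong ([ 3 ] ℚ.*_) (t≗t*1 n))) ⟩
    constant 1 n ℚ.+ [ 3 ] ℚ.* (t * constant 1) n ℚ.- [ 4 ] ℚ.* (t * β) n
      ≡⟨ solve 3 (λ d T X → d :+ con [ 3 ] :* T :- con [ 4 ] :* X :=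
           con 1ℚ :* d :+ con [ 3 ] :* T :+ con [-4] :* X)
           refl (constant 1 n) ((t * constant 1) n) ((t * β) n) ⟩
    combination 1ℚ (constant 1) [ 3 ] (t * constant 1) [-4] (t * β) n ∎
    where
    linear : Series
    linear = constant 1 + constant 3 * t

  β-quadratic : β ≗ combination [ 2 ] (constant 1) [ 2 ] (t * (β * β)) [-3] (t * β)
  β-quadratic = quadratic radical β radical≗ (√-square radicand refl)
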